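{- Let $n\ge 0$. If $X\subseteq\{0,1\}^n$, then the daisy cube $Q_n(X)$ is a partial cube.
   Context: The $n$-cube $Q_n$ is the graph with vertex set $\{0,1\}^n$, two words being adjacent if they differ in exactly one coordinate ($Q_0=K_1$); hypercubes are the graphs $Q_m$, $m\ge 0$. For $u,v\in\{0,1\}^n$ write $u\le v$ if $u_i\le v_i$ for all $i$. For $X\subseteq\{0,1\}^n$, the daisy cube $Q_n(X)$ generated by $X$ is the subgraph of $Q_n$ induced by $\{u\in\{0,1\}^n : u\le x \text{ for some } x\in X\}$. A subgraph $H$ of a graph $G$ is isometric if $d_H(u,v)=d_G(u,v)$ for all $u,v\in V(H)$. Partial cubes are the (graphs isomorphic to) isometric subgraphs of hypercubes. -}

module Defs where

open import Data.Bool.Base as Bool using (Bool)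
open import Data.Fin.Base using (Fin)
open import Data.Nat.Base using (ℕ; zero; suc; _≤_)
open import Data.Product.Base using (∃; Σ-syntax; ∃-syntax; _×_; _,_; proj₁; proj₂)
open import Data.Product using (∃!)
open import Data.Vec.Base using (Vec; lookup)
open import Function.Base using (_on_; _∘_)
open import Function.Bundles using (Inverse; _⇔_)
open import Level using (Level; 0ℓ; _⊔_) renaming (suc to lsuc)
open import Relation.Binary.Bundles using (Setoid)
open import Relation.Binary.Core using (Rel)
open import Relation.Binary.Definitions
  using (Symmetric; Irreflexive; _Respects_; _Respects₂_)
import Relation.Binary.Construct.On as On
open import Relation.Binary.PropositionalEquality
  using (_≡_; _≢_; refl; ≢-sym; setoid)
open import Relation.Unary using (Pred)

private
  variable
    c ℓ e c′ ℓ′ e′ p : Level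

-- Simple graphs.  Vertices form a setoid because the vertices of a
-- subgraph are pairs (v , proof that v belongs to it), which must be
-- identified when they have the same v.

record Graph (c ℓ e : Level) : Set (lsuc (c ⊔ ℓ ⊔ e)) where
  field
    vertexSetoid : Setoid c ℓ

  open Setoid vertexSetoid public using (_≈_) renaming (Carrier to Vertex)

  field
    Adj        : Rel Vertex e
    Adj-resp   : Adj Respects₂ _≈_
    Adj-sym    : Symmetric Adj
    Adj-irrefl : Irreflexive _≈_ Adj

record _≅_ (G : Graph c ℓ e) (H : Graph c′ ℓ′ e′)
         : Set (c ⊔ ℓ ⊔ e ⊔ c′ ⊔ ℓ′ ⊔ e′) where
  private
    module G = Graph G
    module H = Graph H
  field
    vertex-bijection : Inverse G.vertexSetoid H.vertexSetoid

  open Inverse vertex-bijection public using (to; from)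

  field
    adjacency : ∀ u v → G.Adj u v ⇔ H.Adj (to u) (to v)

module _ (G : Graph c ℓ e) where
  open Graph G

  data Walk : Vertex → Vertex → ℕ → Set (c ⊔ ℓ ⊔ e) where
    stop : ∀ {u v} → u ≈ v → Walk u v zero
    step : ∀ {u w v k} → Adj u w → Walk w v k → Walk u v (suc k)

  -- Dist u v k means d(u,v) = k.  The distance is infinite when no k
  -- satisfies this.
  Dist : Vertex → Vertex → ℕ → Set (c ⊔ ℓ ⊔ e)
  Dist u v k = Walk u v k × (∀ j → Walk u v j → k ≤ j)

-- Subgraphs, not necessarily induced.

record Subgraph (G : Graph c ℓ e) (p e′ : Level)
              : Set (c ⊔ ℓ ⊔ e ⊔ lsuc (p ⊔ e′)) where
  open Graph G
  field
    V      : Pred Vertex p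
    V-resp : V Respects _≈_
    E      : Rel (∃ V) e′
    E-resp : E Respects₂ (_≈_ on proj₁)
    E-sym  : Symmetric E
    E⊆Adj  : ∀ {u v} → E u v → Adj (proj₁ u) (proj₁ v)

  graph : Graph (c ⊔ p) ℓ e′
  graph = record
    { vertexSetoid = On.setoid vertexSetoid (proj₁ {B = V})
    ; Adj          = E
    ; Adj-resp     = E-resp
    ; Adj-sym      = E-sym
    ; Adj-irrefl   = λ u≈v uv → Adj-irrefl u≈v (E⊆Adj uv)
    }

induced : (G : Graph c ℓ e) → let open Graph G in
          (P : Pred Vertex p) → P Respects _≈_ → Subgraph G p e
induced G P P-resp = record
  { V      = P
  ; V-resp = P-resp
  ; E      = Adj on proj₁
  ; E-resp = proj₁ Adj-resp , proj₂ Adj-resp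
  ; E-sym  = Adj-sym
  ; E⊆Adj  = λ uv → uv
  }
  where open Graph G

-- d_H(u,v) = d_G(u,v) as extended natural numbers: either both are the
-- same finite k or both are infinite.

Isometric : {G : Graph c ℓ e} → Subgraph G p e′ → Set (c ⊔ ℓ ⊔ e ⊔ p ⊔ e′)
Isometric {G = G} H =
  ∀ u v k → Dist (Subgraph.graph H) u v k ⇔ Dist G (proj₁ u) (proj₁ v) k

Word : ℕ → Set
Word n = Vec Bool n

infix 4 _≤ʷ_

_≤ʷ_ : ∀ {n} → Rel (Word n) 0ℓ
u ≤ʷ v = ∀ i → lookup u i Bool.≤ lookup v i

DifferInExactlyOne : ∀ {n} → Rel (Word n) 0ℓ
DifferInExactlyOne u v = ∃! _≡_ (λ i → lookup u i ≢ lookup v i)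

Q : ℕ → Graph 0ℓ 0ℓ 0ℓ
Q n = record
  { vertexSetoid = setoid (Word n)
  ; Adj          = DifferInExactlyOne
  ; Adj-resp     = (λ { refl d → d }) , (λ { refl d → d })
  ; Adj-sym      = λ { (i , ≢i , unique) → i , ≢-sym ≢i , unique ∘ ≢-sym }
  ; Adj-irrefl   = λ { refl (i , ≢i , _) → ≢i refl }
  }

-- The levels of H lose no generality: the image of G in Q m is a
-- predicate at the level of the vertices of G.

IsPartialCube : Graph c ℓ e → Set (lsuc (c ⊔ e) ⊔ ℓ)
IsPartialCube {c} {ℓ} {e} G =
  ∃[ m ] Σ[ H ∈ Subgraph (Q m) c e ] (Isometric H × G ≅ Subgraph.graph H)

daisyCube : (n : ℕ) → Pred (Word n) ℓ → Subgraph (Q n) ℓ 0ℓ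
daisyCube n X =
  induced (Q n) (λ u → ∃[ x ] X x × u ≤ʷ x) (λ { refl u∈ → u∈ })

{-# OPTIONS --safe #-}
module Submission where

-- The Hamming distance bounds the length of every walk from below, since it
-- changes by at most 1 along an edge.  Conversely, in a downward closed set of
-- words, two words are joined by a walk of exactly that length: coordinate by
-- coordinate, every 1 → 0 change is made at the start of the walk and every
-- 0 → 1 change at its end, so that all words in between lie below one of the
-- two endpoints.

open import Defs
open import Data.Bool.Base as Bool using (Bool; true; false; f≤t; b≤b; if_then_else_; _xor_)
import Data.Bool.Properties as Bool
open import Data.Fin.Base using (zero; suc)
open import Data.Fin.Properties using (suc-injective)
open import Data.Nat.Base using (ℕ; zero; suc; _+_; _≤_; z≤n; s≤s)
open import Data.Nat.Properties
  using (≤-refl; ≤-trans; ≤-reflexive; ≤-antisym; +-monoˡ-≤; +-monoʳ-≤; +-suc; m≤n+m)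
open import Data.Product.Base using (_,_; proj₁; proj₂)
open import Data.Vec.Base using ([]; _∷_; lookup)
open import Data.Vec.Relation.Binary.Pointwise.Extensional using (ext; Pointwise-≡⇒≡)
open import Function.Base using (_∘_; id)
open import Function.Bundles using (mk⇔)
open import Function.Construct.Identity using (inverse)
open import Level using (Level)
open import Relation.Binary.Bundles using (Setoid)
open import Relation.Binary.PropositionalEquality
  using (_≡_; _≢_; refl; cong; subst)
open import Relation.Nullary.Decidable using (decidable-stable)
open import Relation.Nullary.Negation using (contradiction)
open import Relation.Unary using (Pred)

private
  variable
    ℓ c e c′ ℓ′ e′ : Level
    n k : ℕ

≅-refl : (G : Graph c ℓ e) → G ≅ G
≅-refl G = record
  { vertex-bijection = inverse (Graph.vertexSetoid G)
  ; adjacency        = λ _ _ → mk⇔ id id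
  }

-- `step` extends a walk only at its start; the 0 → 1 changes have to be appended at the end.
walk-snoc : (G : Graph c ℓ e) → let open Graph G in
            ∀ {u w v} → Walk G u w k → Adj w v → Walk G u v (suc k)
walk-snoc G (stop u≈w)  wv = step (proj₂ Adj-resp (Setoid.sym vertexSetoid u≈w) wv)
                                  (stop (Setoid.refl vertexSetoid))
  where open Graph G
walk-snoc G (step ux p) wv = step ux (walk-snoc G p wv)

module _ (G : Graph c ℓ e) (H : Graph c′ ℓ′ e′) where
  private
    module G = Graph G
    module H = Graph H

  walk-map : (f : G.Vertex → H.Vertex) →
             (∀ {u v} → u G.≈ v → f u H.≈ f v) →
             (∀ {u v} → G.Adj u v → H.Adj (f u) (f v)) →
             ∀ {u v} → Walk G u v k → Walk H (f u) (f v) k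
  walk-map f f-≈ f-Adj (stop u≈v)  = stop (f-≈ u≈v)
  walk-map f f-≈ f-Adj (step uw p) = step (f-Adj uw) (walk-map f f-≈ f-Adj p)

differ-head : ∀ {b c} (u : Word n) → b ≢ c → DifferInExactlyOne (b ∷ u) (c ∷ u)
differ-head u b≢c = zero , b≢c ,
  λ { {zero} _ → refl ; {suc _} ≢i → contradiction refl ≢i }

differ-∷ : ∀ b {u v : Word n} → DifferInExactlyOne u v →
           DifferInExactlyOne (b ∷ u) (b ∷ v)
differ-∷ b (i , ≢i , unique) = suc i , ≢i ,
  λ { {zero} b≢b → contradiction refl b≢b ; {suc _} ≢j → cong suc (unique ≢j) }

private
  mismatch : Bool → Bool → ℕ
  mismatch b c = if b xor c then 1 else 0

  mismatch≤1 : ∀ b c → mismatch b c ≤ 1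
  mismatch≤1 false false = z≤n
  mismatch≤1 false true  = ≤-refl
  mismatch≤1 true  false = ≤-refl
  mismatch≤1 true  true  = z≤n

-- By recursion on the words, so that the lengths required in `geodesic` reduce by computation once
-- the leading bits are known.
hamming : Word n → Word n → ℕ
hamming []      []      = 0
hamming (b ∷ u) (c ∷ v) = mismatch b c + hamming u v

hamming-refl : (u : Word n) → hamming u u ≡ 0
hamming-refl []          = refl
hamming-refl (false ∷ u) = hamming-refl u
hamming-refl (true  ∷ u) = hamming-refl u

hamming-adjacent : (u w v : Word n) → DifferInExactlyOne u w →
                   hamming u v ≤ suc (hamming w v)
hamming-adjacent (b ∷ u) (c ∷ w) (d ∷ v) (zero , _ , unique)
  -- The head is the only differing coordinate: a disagreement in the tails would give
  -- `zero ≡ suc i`. Hence the tails coincide and only the head's mismatch, at most 1, can change.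
  with refl ← Pointwise-≡⇒≡ {xs = u} {ys = w} (ext λ i →
                decidable-stable (lookup u i Bool.≟ lookup w i)
                  λ ≢i → contradiction (unique {suc i} ≢i) λ ())
  = ≤-trans (+-monoˡ-≤ (hamming u v) (mismatch≤1 b d))
            (s≤s (m≤n+m (hamming u v) (mismatch c d)))
hamming-adjacent (b ∷ u) (c ∷ w) (d ∷ v) (suc i , ≢i , unique)
  with refl ← decidable-stable (b Bool.≟ c) (λ b≢c → contradiction (unique {zero} b≢c) λ ())
  = ≤-trans (+-monoʳ-≤ (mismatch b d)
               (hamming-adjacent u w v (i , ≢i , λ ≢j → suc-injective (unique ≢j))))
            (≤-reflexive (+-suc (mismatch b d) (hamming w v)))

hamming≤walk : ∀ {u v : Word n} → Walk (Q n) u v k → hamming u v ≤ k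
hamming≤walk (stop {u} refl)          = ≤-reflexive (hamming-refl u)
hamming≤walk (step {u} {w} {v} uw wv) =
  ≤-trans (hamming-adjacent u w v uw) (s≤s (hamming≤walk wv))

DownwardClosed : Pred (Word n) ℓ → Set ℓ
DownwardClosed P = ∀ {u v} → u ≤ʷ v → P v → P u

≤ʷ-refl : (u : Word n) → u ≤ʷ u
≤ʷ-refl u _ = b≤b

≤ʷ-∷ : ∀ {b c} {u v : Word n} → b Bool.≤ c → u ≤ʷ v → (b ∷ u) ≤ʷ (c ∷ v)
≤ʷ-∷ b≤c u≤v zero    = b≤c
≤ʷ-∷ b≤c u≤v (suc i) = u≤v i

inducedQ : Pred (Word n) ℓ → Subgraph (Q n) ℓ _
inducedQ {n = n} P = induced (Q n) P (λ { refl Pu → Pu })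

-- Prefixing `b` embeds the slice of `P` at `b` as a face, so that geodesics can be built by
-- recursion on tails.
walk-∷ : ∀ b {P : Pred (Word (suc n)) ℓ} {u v Pu Pv} →
         Walk (Subgraph.graph (inducedQ (P ∘ (b ∷_)))) (u , Pu) (v , Pv) k →
         Walk (Subgraph.graph (inducedQ P)) (b ∷ u , Pu) (b ∷ v , Pv) k
walk-∷ b {P} = walk-map (Subgraph.graph (inducedQ (P ∘ (b ∷_)))) (Subgraph.graph (inducedQ P))
                 (λ (u , Pu) → b ∷ u , Pu) (cong (b ∷_)) (differ-∷ b)

-- The induction runs over all downward closed sets at once, because each slice `P ∘ (b ∷_)` is
-- again downward closed.
geodesic : {P : Pred (Word n) ℓ} → DownwardClosed P → ∀ u v Pu Pv →
           Walk (Subgraph.graph (inducedQ P)) (u , Pu) (v , Pv) (hamming u v)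
geodesic ↓P [] [] Pu Pv = stop refl
geodesic ↓P (false ∷ u) (false ∷ v) Pu Pv =
  walk-∷ false (geodesic (↓P ∘ ≤ʷ-∷ b≤b) u v Pu Pv)
geodesic ↓P (true ∷ u) (true ∷ v) Pu Pv =
  walk-∷ true (geodesic (↓P ∘ ≤ʷ-∷ b≤b) u v Pu Pv)
geodesic ↓P (true ∷ u) (false ∷ v) Pu Pv =
  -- `false ∷ u` lies below the start `true ∷ u`, hence in `P`; the rest of the walk stays in the
  -- slice at `false`.
  step (differ-head u λ ())
       (walk-∷ false (geodesic (↓P ∘ ≤ʷ-∷ b≤b) u v (↓P (≤ʷ-∷ f≤t (≤ʷ-refl u)) Pu) Pv))
geodesic {P = P} ↓P (false ∷ u) (true ∷ v) Pu Pv =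
  -- `true ∷ u` may lie outside `P`, so the leading bit is raised last, from `false ∷ v`, which is
  -- below the endpoint.
  walk-snoc (Subgraph.graph (inducedQ P))
    (walk-∷ false (geodesic (↓P ∘ ≤ʷ-∷ b≤b) u v Pu (↓P (≤ʷ-∷ f≤t (≤ʷ-refl v)) Pv)))
    (differ-head v λ ())

-- The walk `shortest` attains the Hamming bound in the subgraph and, via `forget`, in the cube, so
-- both distances equal `hamming u v`.
downwardClosed⇒isometric : {P : Pred (Word n) ℓ} → DownwardClosed P → Isometric (inducedQ P)
downwardClosed⇒isometric {n = n} {P = P} ↓P (u , Pu) (v , Pv) k = mk⇔
  (λ (p , minimal) → forget p ,
     λ j q → ≤-trans (minimal _ shortest) (hamming≤walk q))
  (λ (p , minimal) →
     -- Being the distance in the cube forces `k` to equal `hamming u v`, so `shortest` is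
     -- transported to length `k`.
     subst (Walk H _ _) (≤-antisym (hamming≤walk p) (minimal _ (forget shortest))) shortest ,
     λ j q → minimal j (forget q))
  where
  H = Subgraph.graph (inducedQ P)

  forget : ∀ {x y j} → Walk H x y j → Walk (Q n) (proj₁ x) (proj₁ y) j
  forget = walk-map H (Q n) proj₁ id id

  shortest : Walk H (u , Pu) (v , Pv) (hamming u v)
  shortest = geodesic ↓P u v Pu Pv

proposition2p1 : ∀ {ℓ : Level} (n : ℕ) (X : Pred (Word n) ℓ) → IsPartialCube (Subgraph.graph (daisyCube n X))
proposition2p1 n X =
  -- The daisy cube itself serves as the isometric subgraph; its vertex set is downward closed
  -- because a word below `v` lies below the same generator `x`.
  n , daisyCube n X ,
  downwardClosed⇒isometric
    (λ { u≤v (x , x∈X , v≤x) → x , x∈X , λ i → Bool.≤-trans (u≤v i) (v≤x i) }) ,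
  ≅-refl (Subgraph.graph (daisyCube n X))
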